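{- Let $r\ge 2$. Suppose the edges of $K_n$ are $r$-colored and, for each $i\in[r]$, let $G_i$ be the graph on the $n$ vertices whose edges are those of color $i$. Then $$\sum_{i=1}^r k(G_i)\le (r-1)(n+1)+2^n .$$ Moreover, this bound is achieved when $G_i=K_n$ for some $i\in[r]$.
   Context: $[r]=\{1,\dots,r\}$. An $r$-coloring assigns each edge of $K_n$ exactly one color in $[r]$ (colors may be unused). $k(G)$ is the number of cliques of $G$, i.e. vertex subsets inducing a complete subgraph; the empty set and all singletons count as cliques. -}

module Defs where

open import Data.Fin.Base using (Fin)
open import Data.Fin.Properties using (_≟_; all?)
open import Data.Fin.Subset using (Subset; inside; outside; _∈_)
open import Data.Fin.Subset.Properties using (_∈?_)
open import Data.List.Base using (List; []; _∷_; _++_; map; filter; length)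
open import Data.Nat.Base using (ℕ; zero; suc)
open import Data.Product.Base using (Σ-syntax; _,_)
import Data.Vec.Base as Vec
open import Function.Bundles using (_⇔_)
open import Level using (0ℓ)
open import Relation.Binary.Core using (Rel)
open import Relation.Binary.Definitions using (Symmetric; Irreflexive; Decidable)
open import Relation.Binary.PropositionalEquality using (_≡_; _≢_; sym; trans; ≢-sym)
open import Relation.Nullary using (Dec; yes; no)
open import Relation.Nullary.Decidable using (map′; ¬?; _→-dec_)

record Graph (n : ℕ) : Set₁ where
  field
    Adj    : Rel (Fin n) 0ℓ
    symm   : Symmetric Adj
    irrefl : Irreflexive _≡_ Adj
    adj?   : Decidable Adj

open Graph public

-- Equality of labelled graphs: the two graphs have the same edges.
infix 4 _≈ᴳ_
_≈ᴳ_ : ∀ {n} → Graph n → Graph n → Set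
G ≈ᴳ H = ∀ u v → Adj G u v ⇔ Adj H u v

K : ∀ n → Graph n
K n = record
  { Adj    = _≢_
  ; symm   = ≢-sym
  ; irrefl = λ u≡v u≢v → u≢v u≡v
  ; adj?   = λ u v → ¬? (u ≟ v)
  }

IsClique : ∀ {n} → Graph n → Subset n → Set
IsClique G S = ∀ u v → u ∈ S → v ∈ S → u ≢ v → Adj G u v

isClique? : ∀ {n} (G : Graph n) (S : Subset n) → Dec (IsClique G S)
isClique? G S = all? λ u → all? λ v →
  (u ∈? S) →-dec ((v ∈? S) →-dec (¬? (u ≟ v) →-dec adj? G u v))

-- Every subset of Fin n is listed exactly once.
subsets : ∀ n → List (Subset n)
subsets zero    = Vec.[] ∷ []
subsets (suc n) = map (inside Vec.∷_) (subsets n) ++ map (outside Vec.∷_) (subsets n)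

k : ∀ {n} → Graph n → ℕ
k {n} G = length (filter (isClique? G) (subsets n))

-- The edge {u , v} of K n is given by an ordered pair of distinct vertices.
-- Its colour depends neither on the order (symmetric) nor on the proof of
-- distinctness (irrelevant argument).
record EdgeColoring (r n : ℕ) : Set where
  field
    color     : (u v : Fin n) → .(u ≢ v) → Fin r
    symmetric : ∀ u v (u≢v : u ≢ v) → color u v u≢v ≡ color v u (≢-sym u≢v)

colorClass : ∀ {r n} → EdgeColoring r n → Fin r → Graph n
colorClass c i = record
  { Adj    = λ u v → Σ[ u≢v ∈ u ≢ v ] color u v u≢v ≡ i
  ; symm   = λ {u} {v} (u≢v , eq) → ≢-sym u≢v , trans (sym (symmetric u v u≢v)) eq
  ; irrefl = λ u≡v (u≢v , _) → u≢v u≡v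
  ; adj?   = dec
  }
  where
  open EdgeColoring c
  dec : ∀ u v → Dec (Σ[ u≢v ∈ u ≢ v ] color u v u≢v ≡ i)
  dec u v with u ≟ v
  ... | yes u≡v = no λ (u≢v , _) → u≢v u≡v
  ... | no  u≢v = map′ (u≢v ,_) (λ (_ , eq) → eq) (color u v u≢v ≟ i)

{-# OPTIONS --safe #-}

-- Double counting: ∑ᵢ k(Gᵢ) = ∑_S #{i : S is a clique of Gᵢ}.  Each of the n + 1
-- sets of size at most 1 is a clique in all r colours, while a larger set is a
-- clique in at most one colour, namely that of any of its edges.  Hence S
-- contributes at most (r − 1)[∣S∣ ≤ 1] + 1, and exactly that if one colour class
-- is complete.

module Submission where

open import Defs
open import Data.Nat.Properties using (+-0-commutativeMonoid)
open import Algebra.Properties.CommutativeMonoid.Sum +-0-commutativeMonoid using (sum-syntax)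
open import Data.Nat.Base using (ℕ; _≤_; _+_; _*_; _∸_; _^_)
open import Data.Product.Base using (∃; _×_)
open import Relation.Binary.PropositionalEquality using (_≡_)

open import Algebra.Properties.CommutativeMonoid.Sum +-0-commutativeMonoid
  using (sum-cong-≗; sum-replicate-zero; ∑-distrib-+)
open import Data.Bool.Base using (if_then_else_; true; false)
open import Data.Fin.Base using (Fin; zero; suc)
open import Data.Fin.Properties using (_≟_; suc-injective)
open import Data.Fin.Subset using (Subset; inside; outside; _∈_; ∣_∣; Nonempty)
open import Data.Fin.Subset.Properties using (x∈p⇒∣p-x∣<∣p∣)
open import Data.List.Base using (List; []; _∷_; map; filter; length)
open import Data.Nat.ListAction using (sum)
open import Data.List.Properties using (map-++; map-∘; length-++; length-map)
open import Data.Nat.Base using (zero; suc; _<_; _≮_; _≥_; z≤n; s≤s; s≤s⁻¹)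
open import Data.Nat.ListAction.Properties using (sum-++)
open import Data.Nat.Properties hiding (_≟_; suc-injective)
open import Data.Nat.Tactic.RingSolver using (solve-∀)
open import Data.Product.Base using (_,_; ∃₂)
open import Data.Vec.Base using (_∷_; here; there)
open import Function.Base using (_∘_)
open import Function.Bundles using (module Equivalence)
open import Relation.Binary.PropositionalEquality
  using (_≢_; refl; sym; trans; cong; cong₂; subst; module ≡-Reasoning)
open import Relation.Nullary using (¬_; Dec; does; yes; no; contradiction)
open import Relation.Unary using (Decidable)

-- Indicators of decisions and their sums over colours

𝟙 : {P : Set} → Dec P → ℕ
𝟙 P? = if does P? then 1 else 0

𝟙-mono : {P Q : Set} (P? : Dec P) (Q? : Dec Q) → (P → Q) → 𝟙 P? ≤ 𝟙 Q?
𝟙-mono (no _)  _       _   = z≤n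
𝟙-mono (yes p) (yes _) _   = ≤-refl
𝟙-mono (yes p) (no ¬q) P⇒Q = contradiction (P⇒Q p) ¬q

𝟙-yes : {P : Set} (P? : Dec P) → P → 𝟙 P? ≡ 1
𝟙-yes (yes _) _ = refl
𝟙-yes (no ¬p) p = contradiction p ¬p

𝟙-no : {P : Set} (P? : Dec P) → ¬ P → 𝟙 P? ≡ 0
𝟙-no (yes p) ¬p = contradiction p ¬p
𝟙-no (no _)  _  = refl

∑-mono : ∀ {r} {f g : Fin r → ℕ} → (∀ i → f i ≤ g i) → ∑[ i < r ] f i ≤ ∑[ i < r ] g i
∑-mono {zero}  f≤g = z≤n
∑-mono {suc r} f≤g = +-mono-≤ (f≤g zero) (∑-mono (f≤g ∘ suc))

∑-𝟙-universal : ∀ {r} {P : Fin r → Set} (P? : Decidable P) → (∀ i → P i) → ∑[ i < r ] 𝟙 (P? i) ≡ r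
∑-𝟙-universal {zero}  P? ∀P = refl
∑-𝟙-universal {suc r} P? ∀P with P? zero
... | yes _ = cong suc (∑-𝟙-universal (P? ∘ suc) (∀P ∘ suc))
... | no ¬p = contradiction (∀P zero) ¬p

∑-𝟙-≟ : ∀ {r} (j : Fin r) → ∑[ i < r ] 𝟙 (i ≟ j) ≡ 1
-- `𝟙` reads only `does`, so indicators compute through constructors: `𝟙 (suc i ≟ zero)` reduces to
-- 0, and `𝟙 (suc i ≟ suc j)` to `𝟙 (i ≟ j)`.
∑-𝟙-≟ {suc r} zero    = cong suc (sum-replicate-zero r)
∑-𝟙-≟ {suc r} (suc j) = ∑-𝟙-≟ j

-- The indicator of `P` lies pointwise below that of the single colour `j`.
∑-𝟙-≤1 : ∀ {r} {P : Fin r → Set} (P? : Decidable P) {j} → (∀ i → P i → i ≡ j) → ∑[ i < r ] 𝟙 (P? i) ≤ 1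
∑-𝟙-≤1 P? {j} P⇒≡j =
  ≤-trans (∑-mono λ i → 𝟙-mono (P? i) (i ≟ j) (P⇒≡j i)) (≤-reflexive (∑-𝟙-≟ j))

∑-𝟙-≥1 : ∀ {r} {P : Fin r → Set} (P? : Decidable P) {j} → P j → ∑[ i < r ] 𝟙 (P? i) ≥ 1
∑-𝟙-≥1 {P = P} P? {j} Pj =
  ≤-trans (≤-reflexive (sym (∑-𝟙-≟ j)))
          (∑-mono λ i → 𝟙-mono (i ≟ j) (P? i) λ i≡j → subst P (sym i≡j) Pj)

-- Sums over lists

module _ {A : Set} where

  length-filter-∷ : {P : A → Set} (P? : Decidable P) (x : A) (xs : List A) →
                    length (filter P? (x ∷ xs)) ≡ 𝟙 (P? x) + length (filter P? xs)
  length-filter-∷ P? x xs with does (P? x)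
  ... | true  = refl
  ... | false = refl

  -- Double counting of the pairs `(i , x)` with `P i x`, grouped by `i` on the left and by list
  -- entry on the right.
  ∑-length-filter : ∀ {r} {P : Fin r → A → Set} (P? : ∀ i → Decidable (P i)) (xs : List A) →
                    ∑[ i < r ] length (filter (P? i) xs) ≡ sum (map (λ x → ∑[ i < r ] 𝟙 (P? i x)) xs)
  ∑-length-filter {r} P? []       = sum-replicate-zero r
  ∑-length-filter {r} P? (x ∷ xs) = begin
    ∑[ i < r ] length (filter (P? i) (x ∷ xs))
      ≡⟨ sum-cong-≗ (λ i → length-filter-∷ (P? i) x xs) ⟩
    ∑[ i < r ] (𝟙 (P? i x) + length (filter (P? i) xs))
      ≡⟨ ∑-distrib-+ (λ i → 𝟙 (P? i x)) (λ i → length (filter (P? i) xs)) ⟩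
    ∑[ i < r ] 𝟙 (P? i x) + ∑[ i < r ] length (filter (P? i) xs)
      ≡⟨ cong (∑[ i < r ] 𝟙 (P? i x) +_) (∑-length-filter P? xs) ⟩
    sum (map (λ y → ∑[ i < r ] 𝟙 (P? i y)) (x ∷ xs)) ∎
    where open ≡-Reasoning

  sum-map-mono : {f g : A → ℕ} → (∀ x → f x ≤ g x) → ∀ xs → sum (map f xs) ≤ sum (map g xs)
  sum-map-mono f≤g []       = z≤n
  sum-map-mono f≤g (x ∷ xs) = +-mono-≤ (f≤g x) (sum-map-mono f≤g xs)

  sum-map-affine : ∀ m (f : A → ℕ) xs →
                   sum (map (λ x → m * f x + 1) xs) ≡ m * sum (map f xs) + length xs
  sum-map-affine m f []       = sym (trans (+-identityʳ _) (*-zeroʳ m))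
  sum-map-affine m f (x ∷ xs) =
    trans (cong (m * f x + 1 +_) (sum-map-affine m f xs)) (rearrange m (f x) (sum (map f xs)) (length xs))
    where
    rearrange : ∀ m a s l → m * a + 1 + (m * s + l) ≡ m * (a + s) + (1 + l)
    rearrange = solve-∀

-- Counting subsets by size

sum-map-subsets : ∀ {n} (f : Subset (suc n) → ℕ) →
                  sum (map f (subsets (suc n))) ≡
                  sum (map (f ∘ (inside ∷_)) (subsets n)) + sum (map (f ∘ (outside ∷_)) (subsets n))
sum-map-subsets {n} f = begin
  sum (map f (subsets (suc n)))
    ≡⟨ cong sum (map-++ f (map (inside ∷_) (subsets n)) _) ⟩
  _ ≡⟨ sum-++ (map f (map (inside ∷_) (subsets n))) _ ⟩
  _ ≡⟨ cong₂ (λ xs ys → sum xs + sum ys) (map-∘ (subsets n)) (map-∘ (subsets n)) ⟨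
  sum (map (f ∘ (inside ∷_)) (subsets n)) + sum (map (f ∘ (outside ∷_)) (subsets n)) ∎
  where open ≡-Reasoning

length-subsets : ∀ n → length (subsets n) ≡ 2 ^ n
length-subsets zero    = refl
length-subsets (suc n) = begin
  length (subsets (suc n))
    ≡⟨ length-++ (map (inside ∷_) (subsets n)) ⟩
  _ ≡⟨ cong₂ _+_ (length-map _ (subsets n)) (length-map _ (subsets n)) ⟩
  length (subsets n) + length (subsets n)
    ≡⟨ cong (λ l → l + l) (length-subsets n) ⟩
  2 ^ n + 2 ^ n
    ≡⟨ cong (2 ^ n +_) (+-identityʳ (2 ^ n)) ⟨
  2 ^ suc n ∎
  where open ≡-Reasoning

#subsets< : ℕ → ℕ → ℕ
#subsets< j n = sum (map (λ (S : Subset n) → 𝟙 (∣ S ∣ <? j)) (subsets n))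

#subsets<0 : ∀ n → #subsets< 0 n ≡ 0
#subsets<0 zero    = refl
#subsets<0 (suc n) = trans (sum-map-subsets {n} _) (cong₂ _+_ (#subsets<0 n) (#subsets<0 n))

-- Pascal's rule: containing the first vertex uses up one unit of the size bound, so the `inside`
-- half counts `#subsets< 0 n` and the `outside` half `#subsets< 1 n`. Both identifications hold by
-- computation.
#subsets<1 : ∀ n → #subsets< 1 n ≡ 1
#subsets<1 zero    = refl
#subsets<1 (suc n) = trans (sum-map-subsets {n} _) (cong₂ _+_ (#subsets<0 n) (#subsets<1 n))

#subsets<2 : ∀ n → #subsets< 2 n ≡ n + 1
#subsets<2 zero    = refl
#subsets<2 (suc n) = trans (sum-map-subsets {n} _) (cong₂ _+_ (#subsets<1 n) (#subsets<2 n))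

-- Elements of small and large subsets

0<∣p∣⇒nonempty : ∀ {n} (p : Subset n) → 0 < ∣ p ∣ → Nonempty p
0<∣p∣⇒nonempty (inside  ∷ p) _   = zero , here
0<∣p∣⇒nonempty (outside ∷ p) 0<p = let u , u∈p = 0<∣p∣⇒nonempty p 0<p in suc u , there u∈p

-- The witnesses are the two smallest elements; they supply an edge inside any set that is not
-- small.
1<∣p∣⇒distinct : ∀ {n} (p : Subset n) → 1 < ∣ p ∣ → ∃₂ λ u v → u ∈ p × v ∈ p × u ≢ v
1<∣p∣⇒distinct (inside ∷ p) 1<p =
  let v , v∈p = 0<∣p∣⇒nonempty p (s≤s⁻¹ 1<p) in zero , suc v , here , there v∈p , λ ()
1<∣p∣⇒distinct (outside ∷ p) 1<p =
  let u , v , u∈p , v∈p , u≢v = 1<∣p∣⇒distinct p 1<p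
  in suc u , suc v , there u∈p , there v∈p , u≢v ∘ suc-injective

∣p∣<2⇒≡ : ∀ {n} (p : Subset n) {u v} → ∣ p ∣ < 2 → u ∈ p → v ∈ p → u ≡ v
∣p∣<2⇒≡ _             _   here        here        = refl
-- The head is `inside`, so `p<2` leaves `∣ p ∣ ≤ 0`, which is impossible since removing `v` would
-- make `p` strictly smaller.
∣p∣<2⇒≡ (_ ∷ p)       p<2 here        (there v∈p) =
  contradiction (≤-trans (x∈p⇒∣p-x∣<∣p∣ v∈p) (s≤s⁻¹ (s≤s⁻¹ p<2))) n≮0
∣p∣<2⇒≡ (_ ∷ p)       p<2 (there u∈p) here        =
  contradiction (≤-trans (x∈p⇒∣p-x∣<∣p∣ u∈p) (s≤s⁻¹ (s≤s⁻¹ p<2))) n≮0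
-- Here `∣ p ∣ < 1`; weakening this to `∣ p ∣ < 2` allows the recursive call.
∣p∣<2⇒≡ (inside  ∷ p) p<2 (there u∈p) (there v∈p) = cong suc (∣p∣<2⇒≡ p (m<n⇒m<1+n (s≤s⁻¹ p<2)) u∈p v∈p)
∣p∣<2⇒≡ (outside ∷ p) p<2 (there u∈p) (there v∈p) = cong suc (∣p∣<2⇒≡ p p<2 u∈p v∈p)

-- Vacuous: there is no pair of distinct vertices to test.
∣S∣<2⇒clique : ∀ {n} (G : Graph n) (S : Subset n) → ∣ S ∣ < 2 → IsClique G S
∣S∣<2⇒clique G S S<2 u v u∈S v∈S u≢v = contradiction (∣p∣<2⇒≡ S S<2 u∈S v∈S) u≢v

-- Clique colours of a set against its weight

module _ {m n} (c : EdgeColoring (suc m) n) where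

  #cliqueColors : Subset n → ℕ
  #cliqueColors S = ∑[ i < suc m ] 𝟙 (isClique? (colorClass c i) S)

  -- Affine in the indicator rather than defined by cases, so that `sum-map-affine` totals it. The
  -- factor `m` is the number of colours minus one.
  weight : Subset n → ℕ
  weight S = m * 𝟙 (∣ S ∣ <? 2) + 1

  ∑k≡sum-#cliqueColors : ∑[ i < suc m ] k (colorClass c i) ≡ sum (map #cliqueColors (subsets n))
  ∑k≡sum-#cliqueColors = ∑-length-filter (isClique? ∘ colorClass c) (subsets n)

  -- The factor of `m` counts the sets of size at most 1, and the constant 1 is collected once per
  -- subset.
  sum-weight : sum (map weight (subsets n)) ≡ m * (n + 1) + 2 ^ n
  sum-weight = trans (sum-map-affine m _ (subsets n))
                     (cong₂ (λ s l → m * s + l) (#subsets<2 n) (length-subsets n))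

  weight-small : ∀ S → ∣ S ∣ < 2 → weight S ≡ suc m
  weight-small S S<2 = begin
    m * 𝟙 (∣ S ∣ <? 2) + 1 ≡⟨ cong (λ a → m * a + 1) (𝟙-yes (∣ S ∣ <? 2) S<2) ⟩
    m * 1 + 1              ≡⟨ cong (_+ 1) (*-identityʳ m) ⟩
    m + 1                  ≡⟨ +-comm m 1 ⟩
    suc m                  ∎
    where open ≡-Reasoning

  weight-large : ∀ S → ∣ S ∣ ≮ 2 → weight S ≡ 1
  weight-large S S≮2 = begin
    m * 𝟙 (∣ S ∣ <? 2) + 1 ≡⟨ cong (λ a → m * a + 1) (𝟙-no (∣ S ∣ <? 2) S≮2) ⟩
    m * 0 + 1              ≡⟨ cong (_+ 1) (*-zeroʳ m) ⟩
    1                      ∎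
    where open ≡-Reasoning

  #cliqueColors-small : ∀ S → ∣ S ∣ < 2 → #cliqueColors S ≡ suc m
  #cliqueColors-small S S<2 =
    ∑-𝟙-universal (λ i → isClique? (colorClass c i) S) λ i → ∣S∣<2⇒clique (colorClass c i) S S<2

  #cliqueColors-large : ∀ S → 1 < ∣ S ∣ → #cliqueColors S ≤ 1
  #cliqueColors-large S 1<S =
    let u , v , u∈S , v∈S , u≢v = 1<∣p∣⇒distinct S 1<S
    -- Any colour in which `S` is a clique must be the colour of the edge between `u` and `v`.
    in ∑-𝟙-≤1 (λ i → isClique? (colorClass c i) S) {EdgeColoring.color c u v u≢v}
         λ i clique → let _ , color≡i = clique u v u∈S v∈S u≢v in sym color≡i

  #cliqueColors≤weight : ∀ S → #cliqueColors S ≤ weight S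
  #cliqueColors≤weight S with ∣ S ∣ <? 2
  ... | yes S<2 = ≤-reflexive (trans (#cliqueColors-small S S<2) (sym (weight-small S S<2)))
  ... | no  S≮2 = ≤-trans (#cliqueColors-large S (≮⇒≥ S≮2)) (≤-reflexive (sym (weight-large S S≮2)))

  -- Small sets reach their weight under any colouring. A larger set has weight 1, already supplied
  -- by colour `i`, since every set is a clique of a complete graph.
  weight≤#cliqueColors : ∀ i → colorClass c i ≈ᴳ K n → ∀ S → weight S ≤ #cliqueColors S
  weight≤#cliqueColors i Gᵢ≈K S with ∣ S ∣ <? 2
  ... | yes S<2 = ≤-reflexive (trans (weight-small S S<2) (sym (#cliqueColors-small S S<2)))
  ... | no  S≮2 = ≤-trans (≤-reflexive (weight-large S S≮2))
    (∑-𝟙-≥1 (λ j → isClique? (colorClass c j) S) {i} λ u v _ _ u≢v → Equivalence.from (Gᵢ≈K u v) u≢v)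

proposition1p9 : (r : ℕ) → 2 ≤ r → (n : ℕ) (c : EdgeColoring r n) →
    (∑[ i < r ] k (colorClass c i) ≤ (r ∸ 1) * (n + 1) + 2 ^ n)
    × ((∃ λ i → colorClass c i ≈ᴳ K n) →
    ∑[ i < r ] k (colorClass c i) ≡ (r ∸ 1) * (n + 1) + 2 ^ n)
-- The case `r = 0` is excluded by `2 ≤ r`, and for `r = suc m` the term `r ∸ 1` reduces to `m`.
proposition1p9 (suc m) _ n c = upper , λ (i , Gᵢ≈K) → ≤-antisym upper (lower i Gᵢ≈K)
  where
  open ≤-Reasoning
  upper : ∑[ i < suc m ] k (colorClass c i) ≤ m * (n + 1) + 2 ^ n
  upper = begin
    ∑[ i < suc m ] k (colorClass c i)       ≡⟨ ∑k≡sum-#cliqueColors c ⟩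
    sum (map (#cliqueColors c) (subsets n)) ≤⟨ sum-map-mono (#cliqueColors≤weight c) (subsets n) ⟩
    sum (map (weight c) (subsets n))        ≡⟨ sum-weight c ⟩
    m * (n + 1) + 2 ^ n                     ∎

  lower : ∀ i → colorClass c i ≈ᴳ K n → m * (n + 1) + 2 ^ n ≤ ∑[ i < suc m ] k (colorClass c i)
  lower i Gᵢ≈K = begin
    m * (n + 1) + 2 ^ n                     ≡⟨ sum-weight c ⟨
    sum (map (weight c) (subsets n))        ≤⟨ sum-map-mono (weight≤#cliqueColors c i Gᵢ≈K) (subsets n) ⟩
    sum (map (#cliqueColors c) (subsets n)) ≡⟨ ∑k≡sum-#cliqueColors c ⟨
    ∑[ i < suc m ] k (colorClass c i)       ∎
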